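{- For all SCL-terms $t$ and $t'$ (possibly containing variables), $$\mathrm{EqFSCL}\vdash t=t'\quad\Longrightarrow\quad \mathrm{FSCL}\vdash t=t' .$$
   Context: Fix a countable set $A$ of atoms, treated as constants. $\curlywedge$ and $\curlyvee$ denote the binary connectives left-sequential (short-circuit) conjunction and disjunction. SCL-terms are terms built from variables, the constants $\mathsf T,\mathsf F$, atoms $a\in A$, the unary $\neg$ and the binary $\curlywedge,\curlyvee$. $\vdash$ is derivability in equational logic. CP is the following set of axioms over the signature with constants $\mathsf T,\mathsf F$, atoms, and the ternary conditional $x\triangleleft y\triangleright z$ (read: if $y$ then $x$ else $z$): (CP1) $x\triangleleft\mathsf T\triangleright y=x$; (CP2) $x\triangleleft\mathsf F\triangleright y=y$; (CP3) $\mathsf T\triangleleft x\triangleright\mathsf F=x$; (CP4) $x\triangleleft(y\triangleleft z\triangleright u)\triangleright v=(x\triangleleft y\triangleright v)\triangleleft z\triangleright(x\triangleleft u\triangleright v)$. FSCL (free short-circuit logic): for SCL-terms $t,t'$, $\mathrm{FSCL}\vdash t=t'$ means that $t=t'$ is derivable in equational logic from CP together with the defining equations $\neg x=\mathsf F\triangleleft x\triangleright\mathsf T$, $x\curlywedge y=y\triangleleft x\triangleright\mathsf F$, and $x\curlyvee y=\neg(\neg x\curlywedge\neg y)$. EqFSCL is the following set of equations over SCL-terms: (SCL1) $\mathsf F=\neg\mathsf T$; (SCL2) $x\curlyvee y=\neg(\neg x\curlywedge\neg y)$; (SCL3) $\neg\neg x=x$; (SCL4) $\mathsf T\curlywedge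 x=x$; (SCL5) $x\curlywedge\mathsf T=x$; (SCL6) $\mathsf F\curlywedge x=\mathsf F$; (SCL7) $(x\curlywedge y)\curlywedge z=x\curlywedge(y\curlywedge z)$; (SCL8) $x\curlywedge\mathsf F=\neg x\curlywedge\mathsf F$; (SCL9) $(x\curlywedge\mathsf F)\curlyvee y=(x\curlyvee\mathsf T)\curlywedge y$; (SCL10) $(x\curlywedge y)\curlyvee(z\curlywedge\mathsf F)=(x\curlyvee(z\curlywedge\mathsf F))\curlywedge(y\curlyvee(z\curlywedge\mathsf F))$. -}

module Defs where

open import Level using (Level; suc)
open import Data.Nat.Base using (ℕ)
open import Data.Vec.Base using (Vec; []; _∷_)
open import Data.Vec.Relation.Binary.Pointwise.Inductive using (Pointwise)
open import Relation.Binary.Core using (Rel)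
open import Relation.Binary.Construct.Union using (_∪_)

-- A signature gives, for each arity n, the set of its n-ary operation symbols.

Signature : (a : Level) → Set (suc a)
Signature a = ℕ → Set a

module _ {a : Level} (S : Signature a) where

  data Term : Set a where
    var : ℕ → Term
    op  : ∀ {n} → S n → Vec Term n → Term

module _ {a : Level} {S : Signature a} where

  infixl 9 _[_] _[_]*

  -- Term and vector versions are mutual: recursion through Data.Vec.map is
  -- not seen to be structural.

  _[_]  : Term S → (ℕ → Term S) → Term S
  _[_]* : ∀ {n} → Vec (Term S) n → (ℕ → Term S) → Vec (Term S) n

  var i   [ σ ] = σ i
  op f ts [ σ ] = op f (ts [ σ ]*)

  []       [ σ ]* = []
  (t ∷ ts) [ σ ]* = t [ σ ] ∷ ts [ σ ]*

  infix 3 _⊢_≈_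

  data _⊢_≈_ (E : Rel (Term S) a) : Rel (Term S) a where
    axiom : ∀ {s t} → E s t → E ⊢ s ≈ t
    refl  : ∀ {t} → E ⊢ t ≈ t
    sym   : ∀ {s t} → E ⊢ s ≈ t → E ⊢ t ≈ s
    trans : ∀ {s t u} → E ⊢ s ≈ t → E ⊢ t ≈ u → E ⊢ s ≈ u
    cong  : ∀ {n} (f : S n) {ss ts : Vec (Term S) n} →
            Pointwise (E ⊢_≈_) ss ts → E ⊢ op f ss ≈ op f ts
    subst : ∀ {s t} (σ : ℕ → Term S) → E ⊢ s ≈ t → E ⊢ s [ σ ] ≈ t [ σ ]

module _ {a : Level} {S S′ : Signature a} (ι : ∀ {n} → S n → S′ n) where

  rename  : Term S → Term S′
  rename* : ∀ {n} → Vec (Term S) n → Vec (Term S′) n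

  rename (var i)   = var i
  rename (op f ts) = op (ι f) (rename* ts)

  rename* []       = []
  rename* (t ∷ ts) = rename t ∷ rename* ts

data SCLOp {a : Level} (A : Set a) : Signature a where
  true false : SCLOp A 0
  atom       : A → SCLOp A 0
  not        : SCLOp A 1
  and or     : SCLOp A 2

-- The signature in which FSCL derivations take place: that of CP together
-- with the connectives introduced by the defining equations.

data CPOp {a : Level} (A : Set a) : Signature a where
  scl  : ∀ {n} → SCLOp A n → CPOp A n
  cond : CPOp A 3

SCLTerm : {a : Level} → Set a → Set a
SCLTerm A = Term (SCLOp A)

CPTerm : {a : Level} → Set a → Set a
CPTerm A = Term (CPOp A)

embed : {a : Level} {A : Set a} → SCLTerm A → CPTerm A
embed = rename scl

module Variables {a : Level} {S : Signature a} where

  x y z u v : Term S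
  x = var 0
  y = var 1
  z = var 2
  u = var 3
  v = var 4

-- Notation for the connectives in any signature containing that of SCL.

module Connectives {a : Level} {A : Set a} {S : Signature a}
                   (ι : ∀ {n} → SCLOp A n → S n) where

  infix  8 ¬_
  infixl 7 _⋏_ _⋎_

  T F : Term S
  T = op (ι true) []
  F = op (ι false) []

  ¬_ : Term S → Term S
  ¬ s = op (ι not) (s ∷ [])

  _⋏_ _⋎_ : Term S → Term S → Term S
  s ⋏ t = op (ι and) (s ∷ t ∷ [])
  s ⋎ t = op (ι or) (s ∷ t ∷ [])

module _ {a : Level} (A : Set a) where

  open Variables

  module _ where

    open Connectives {A = A} {S = SCLOp A} (λ f → f)

    data EqFSCL : Rel (SCLTerm A) a where
      SCL1  : EqFSCL F (¬ T)
      SCL2  : EqFSCL (x ⋎ y) (¬ (¬ x ⋏ ¬ y))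
      SCL3  : EqFSCL (¬ ¬ x) x
      SCL4  : EqFSCL (T ⋏ x) x
      SCL5  : EqFSCL (x ⋏ T) x
      SCL6  : EqFSCL (F ⋏ x) F
      SCL7  : EqFSCL ((x ⋏ y) ⋏ z) (x ⋏ (y ⋏ z))
      SCL8  : EqFSCL (x ⋏ F) (¬ x ⋏ F)
      SCL9  : EqFSCL ((x ⋏ F) ⋎ y) ((x ⋎ T) ⋏ y)
      SCL10 : EqFSCL ((x ⋏ y) ⋎ (z ⋏ F))
                     ((x ⋎ (z ⋏ F)) ⋏ (y ⋎ (z ⋏ F)))

  module _ where

    open Connectives {A = A} {S = CPOp A} scl

    infix 6 _◁_▷_

    -- r ◁ s ▷ t is "if s then r else t".
    _◁_▷_ : CPTerm A → CPTerm A → CPTerm A → CPTerm A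
    r ◁ s ▷ t = op cond (r ∷ s ∷ t ∷ [])

    data CP : Rel (CPTerm A) a where
      CP1 : CP (x ◁ T ▷ y) x
      CP2 : CP (x ◁ F ▷ y) y
      CP3 : CP (T ◁ x ▷ F) x
      CP4 : CP (x ◁ (y ◁ z ▷ u) ▷ v)
               ((x ◁ y ▷ v) ◁ z ▷ (x ◁ u ▷ v))

    data Defining : Rel (CPTerm A) a where
      ¬-def : Defining (¬ x) (F ◁ x ▷ T)
      ⋏-def : Defining (x ⋏ y) (y ◁ x ▷ F)
      ⋎-def : Defining (x ⋎ y) (¬ (¬ x ⋏ ¬ y))

    FSCL : Rel (CPTerm A) a
    FSCL = CP ∪ Defining

{-# OPTIONS --safe #-}

-- The conditional p ◁ s ▷ q can be evaluated by pushing the outcomes p and q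
-- through the connectives of s; CP and the defining equations prove this
-- evaluation correct.  Both sides of each axiom of EqFSCL evaluate to the very
-- same term, and s = T ◁ s ▷ F by CP3.

module Submission where

open import Defs
open import Data.List.Base using (List; []; _∷_)
open import Data.Nat.Base using (ℕ; zero; suc)
open import Data.Sum.Base using (inj₁; inj₂)
open import Data.Vec.Base using (Vec; []; _∷_)
open import Data.Vec.Relation.Binary.Pointwise.Inductive using (Pointwise; []; _∷_)
open import Function.Bundles using (_↣_)
open import Level using (Level)
open import Relation.Binary.Bundles using (Setoid)
open import Relation.Binary.Core using (Rel)
open import Relation.Binary.PropositionalEquality as ≡ using (_≡_)
import Relation.Binary.Reasoning.Setoid as ≈-Reasoning

private variable
  a : Level

⊢-setoid : {S : Signature a} (E : Rel (Term S) a) → Setoid a a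
⊢-setoid E = record
  { _≈_           = E ⊢_≈_
  ; isEquivalence = record { refl = refl ; sym = sym ; trans = trans }
  }

-- The axioms are stated on an initial segment of the variables, so a list of terms fixes an
-- instance, and that instance is the type of `subst (fromList ts) d` by computation alone. The
-- default `var i` is never reached in the uses below.
fromList : {S : Signature a} → List (Term S) → ℕ → Term S
fromList []       i       = var i
fromList (t ∷ ts) zero    = t
fromList (t ∷ ts) (suc i) = fromList ts i

module _ {S S′ : Signature a} (ι : ∀ {n} → S n → S′ n) where

  -- This serves the `subst` case of `rename-⊢`: the translation of an instance is an instance of
  -- the translation.
  rename-[]  : ∀ t σ → rename ι (t [ σ ]) ≡ rename ι t [ (λ i → rename ι (σ i)) ]
  rename-[]* : ∀ {n} (ts : Vec (Term S) n) σ →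
               rename* ι (ts [ σ ]*) ≡ rename* ι ts [ (λ i → rename ι (σ i)) ]*

  rename-[] (var i)   σ = ≡.refl
  rename-[] (op f ts) σ = ≡.cong (op (ι f)) (rename-[]* ts σ)

  rename-[]* []       σ = ≡.refl
  rename-[]* (t ∷ ts) σ = ≡.cong₂ _∷_ (rename-[] t σ) (rename-[]* ts σ)

module _ {S S′ : Signature a} {ι : ∀ {n} → S n → S′ n}
         {E : Rel (Term S) a} {E′ : Rel (Term S′) a}
         (sound : ∀ {s t} → E s t → E′ ⊢ rename ι s ≈ rename ι t) where

  -- Every derivation rule is matched by the same rule over `S′`, so only the axioms, covered by
  -- `sound`, need an argument of their own.
  rename-⊢  : ∀ {s t} → E ⊢ s ≈ t → E′ ⊢ rename ι s ≈ rename ι t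
  rename-⊢* : ∀ {n} {ss ts : Vec (Term S) n} →
              Pointwise (E ⊢_≈_) ss ts →
              Pointwise (E′ ⊢_≈_) (rename* ι ss) (rename* ι ts)

  rename-⊢ (axiom e)   = sound e
  rename-⊢ refl        = refl
  rename-⊢ (sym d)     = sym (rename-⊢ d)
  rename-⊢ (trans d e) = trans (rename-⊢ d) (rename-⊢ e)
  rename-⊢ (cong f ds) = cong (ι f) (rename-⊢* ds)
  rename-⊢ (subst {s} {t} σ d)
    rewrite rename-[] ι s σ | rename-[] ι t σ = subst _ (rename-⊢ d)

  rename-⊢* []       = []
  rename-⊢* (d ∷ ds) = rename-⊢ d ∷ rename-⊢* ds

module _ {A : Set a} where

  open Connectives {A = A} {S = CPOp A} scl

  infix 6 _◂_▸_
  infix 3 _≃_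

  -- The conditional of Defs, which takes A as an additional explicit argument.
  _◂_▸_ : CPTerm A → CPTerm A → CPTerm A → CPTerm A
  p ◂ s ▸ q = op cond (p ∷ s ∷ q ∷ [])

  _≃_ : Rel (CPTerm A) a
  s ≃ t = FSCL A ⊢ s ≈ t

  open ≈-Reasoning (⊢-setoid (FSCL A))

  ◂▸-cong : ∀ {p p′ s s′ q q′} → p ≃ p′ → s ≃ s′ → q ≃ q′ → p ◂ s ▸ q ≃ p′ ◂ s′ ▸ q′
  ◂▸-cong d e f = cong cond (d ∷ e ∷ f ∷ [])

  ◂T▸ : ∀ p q → p ◂ T ▸ q ≃ p
  ◂T▸ p q = subst (fromList (p ∷ q ∷ [])) (axiom (inj₁ CP1))

  ◂F▸ : ∀ p q → p ◂ F ▸ q ≃ q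
  ◂F▸ p q = subst (fromList (p ∷ q ∷ [])) (axiom (inj₁ CP2))

  T◂▸F : ∀ s → T ◂ s ▸ F ≃ s
  T◂▸F s = subst (fromList (s ∷ [])) (axiom (inj₁ CP3))

  ◂◂▸▸ : ∀ p r s t q → p ◂ (r ◂ s ▸ t) ▸ q ≃ (p ◂ r ▸ q) ◂ s ▸ (p ◂ t ▸ q)
  ◂◂▸▸ p r s t q = subst (fromList (p ∷ r ∷ s ∷ t ∷ q ∷ [])) (axiom (inj₁ CP4))

  -- CP4 moves the test `s` to the root, where the constants `F` and `T` of the defining equation
  -- select the outcomes in swapped order.
  ◂¬▸ : ∀ p s q → p ◂ ¬ s ▸ q ≃ q ◂ s ▸ p
  ◂¬▸ p s q = begin
    p ◂ ¬ s ▸ q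
      ≈⟨ ◂▸-cong refl (subst (fromList (s ∷ [])) (axiom (inj₂ ¬-def))) refl ⟩
    p ◂ (F ◂ s ▸ T) ▸ q
      ≈⟨ ◂◂▸▸ p F s T q ⟩
    (p ◂ F ▸ q) ◂ s ▸ (p ◂ T ▸ q)
      ≈⟨ ◂▸-cong (◂F▸ p q) refl (◂T▸ p q) ⟩
    q ◂ s ▸ p ∎

  ◂⋏▸ : ∀ p s t q → p ◂ s ⋏ t ▸ q ≃ (p ◂ t ▸ q) ◂ s ▸ q
  ◂⋏▸ p s t q = begin
    p ◂ s ⋏ t ▸ q
      ≈⟨ ◂▸-cong refl (subst (fromList (s ∷ t ∷ [])) (axiom (inj₂ ⋏-def))) refl ⟩
    p ◂ (t ◂ s ▸ F) ▸ q
      ≈⟨ ◂◂▸▸ p t s F q ⟩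
    (p ◂ t ▸ q) ◂ s ▸ (p ◂ F ▸ q)
      ≈⟨ ◂▸-cong refl refl (◂F▸ p q) ⟩
    (p ◂ t ▸ q) ◂ s ▸ q ∎

  ◂⋎▸ : ∀ p s t q → p ◂ s ⋎ t ▸ q ≃ p ◂ s ▸ (p ◂ t ▸ q)
  ◂⋎▸ p s t q = begin
    p ◂ s ⋎ t ▸ q
      ≈⟨ ◂▸-cong refl (subst (fromList (s ∷ t ∷ [])) (axiom (inj₂ ⋎-def))) refl ⟩
    p ◂ ¬ (¬ s ⋏ ¬ t) ▸ q
      -- The outer negation swaps the outcomes; the inner ones swap them back.
      ≈⟨ ◂¬▸ p (¬ s ⋏ ¬ t) q ⟩
    q ◂ ¬ s ⋏ ¬ t ▸ p
      ≈⟨ ◂⋏▸ q (¬ s) (¬ t) p ⟩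
    (q ◂ ¬ t ▸ p) ◂ ¬ s ▸ p
      ≈⟨ ◂¬▸ (q ◂ ¬ t ▸ p) s p ⟩
    p ◂ s ▸ (q ◂ ¬ t ▸ p)
      ≈⟨ ◂▸-cong refl refl (◂¬▸ q t p) ⟩
    p ◂ s ▸ (p ◂ t ▸ q) ∎

  -- Evaluation in continuation-passing style: `p` and `q` are what follows when the term yields
  -- true or false. Only variables and atoms remain as tests.
  branch : SCLTerm A → CPTerm A → CPTerm A → CPTerm A
  branch (var i)               p q = p ◂ var i ▸ q
  branch (op true [])          p q = p
  branch (op false [])         p q = q
  branch (op (atom b) [])      p q = p ◂ op (scl (atom b)) [] ▸ q
  branch (op not (s ∷ []))     p q = branch s q p
  branch (op and (s ∷ t ∷ [])) p q = branch s (branch t p q) q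
  branch (op or (s ∷ t ∷ []))  p q = branch s p (branch t p q)

  -- The outcomes must be arbitrary, since the induction swaps them at negations and nests them at
  -- binary connectives.
  ◂▸≃branch : ∀ s p q → p ◂ embed s ▸ q ≃ branch s p q
  ◂▸≃branch (var i)               p q = refl
  ◂▸≃branch (op true [])          p q = ◂T▸ p q
  ◂▸≃branch (op false [])         p q = ◂F▸ p q
  ◂▸≃branch (op (atom b) [])      p q = refl
  ◂▸≃branch (op not (s ∷ []))     p q =
    trans (◂¬▸ p (embed s) q) (◂▸≃branch s q p)
  ◂▸≃branch (op and (s ∷ t ∷ [])) p q = begin
    p ◂ embed s ⋏ embed t ▸ q
      ≈⟨ ◂⋏▸ p (embed s) (embed t) q ⟩
    (p ◂ embed t ▸ q) ◂ embed s ▸ q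
      ≈⟨ ◂▸-cong (◂▸≃branch t p q) refl refl ⟩
    branch t p q ◂ embed s ▸ q
      ≈⟨ ◂▸≃branch s (branch t p q) q ⟩
    branch s (branch t p q) q ∎
  ◂▸≃branch (op or (s ∷ t ∷ []))  p q = begin
    p ◂ embed s ⋎ embed t ▸ q
      ≈⟨ ◂⋎▸ p (embed s) (embed t) q ⟩
    p ◂ embed s ▸ (p ◂ embed t ▸ q)
      ≈⟨ ◂▸-cong refl refl (◂▸≃branch t p q) ⟩
    p ◂ embed s ▸ branch t p q
      ≈⟨ ◂▸≃branch s p (branch t p q) ⟩
    branch s p (branch t p q) ∎

  embed≃branch : ∀ s → embed s ≃ branch s T F
  embed≃branch s = trans (sym (T◂▸F (embed s))) (◂▸≃branch s T F)

  EqFSCL-branch : ∀ {s t} → EqFSCL A s t → ∀ p q → branch s p q ≡ branch t p q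
  EqFSCL-branch SCL1  p q = ≡.refl
  EqFSCL-branch SCL2  p q = ≡.refl
  EqFSCL-branch SCL3  p q = ≡.refl
  EqFSCL-branch SCL4  p q = ≡.refl
  EqFSCL-branch SCL5  p q = ≡.refl
  EqFSCL-branch SCL6  p q = ≡.refl
  EqFSCL-branch SCL7  p q = ≡.refl
  -- With `F` on the right, both outcomes of `x` are `q`, so negating `x` has no effect.
  EqFSCL-branch SCL8  p q = ≡.refl
  EqFSCL-branch SCL9  p q = ≡.refl
  -- `z ⋏ F` evaluates to `q ◂ z ▸ q` whatever its true outcome is, so its two copies on the right
  -- agree with the one on the left.
  EqFSCL-branch SCL10 p q = ≡.refl

  EqFSCL-sound : ∀ {s t} → EqFSCL A s t → embed s ≃ embed t
  EqFSCL-sound {s} {t} e = begin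
    embed s      ≈⟨ embed≃branch s ⟩
    branch s T F ≡⟨ EqFSCL-branch e T F ⟩
    branch t T F ≈⟨ embed≃branch t ⟨
    embed t      ∎

proposition1 : ∀ {a} (A : Set a) → A ↣ ℕ →
    (t t′ : SCLTerm A) →
    EqFSCL A ⊢ t ≈ t′ → FSCL A ⊢ embed t ≈ embed t′
proposition1 A _ t t′ = rename-⊢ EqFSCL-sound
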